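{- Let $m\ge 1$ be an integer, let $x_1,\dots,x_m$ be elements of a commutative ring, and let $C_m(x_1,\dots,x_m)$ be the $m\times m$ matrix whose $(p,q)$ entry is $x_{\max(p,\,m+1-q)}$ for $1\le p,q\le m$. Then $$\det C_m(x_1,\dots,x_m)=\begin{cases}(-1)^{\frac{m}{2}}\prod_{i=1}^{m}(x_i-x_{i+1}), & \text{if } m \text{ is even},\\[2pt] (-1)^{\frac{m-1}{2}}\prod_{i=1}^{m}(x_i-x_{i+1}), & \text{if } m \text{ is odd},\end{cases}$$ where $x_{m+1}=0$.
   Context: The matrix is, explicitly, $$C_m(x_1,\dots,x_m)=\begin{pmatrix} x_m & x_{m-1} & \cdots & x_2 & x_1\\ x_m & x_{m-1} & \cdots & x_2 & x_2\\ \vdots&\vdots&\ddots&\vdots&\vdots\\ x_m & x_{m-1} & \cdots & x_{m-1} & x_{m-1}\\ x_m & x_m&\cdots & x_m & x_m\end{pmatrix}.$$ -}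

module Defs where

open import Algebra.Bundles using (CommutativeRing)
open import Data.Fin.Base using (Fin; zero; toℕ; fromℕ; inject₁; suc; opposite; punchIn)
open import Data.Fin.Properties using (≤-totalOrder)
open import Data.Nat.Base using (ℕ; zero; suc)
open import Data.Vec.Functional using (Vector; insertAt)
import Algebra.Construct.NaturalChoice.Max as Max
import Algebra.Properties.Monoid.Sum as Sum
import Algebra.Properties.Semiring.Exp as Exp

infixl 6 _⊔ᶠ_

_⊔ᶠ_ : ∀ {n} → Fin n → Fin n → Fin n
_⊔ᶠ_ {n} = Max._⊔_ (≤-totalOrder n)

module Matrices {c ℓ} (R : CommutativeRing c ℓ) where

  open CommutativeRing R hiding (zero)
  open Exp semiring public using (_^_)
  open Sum +-monoid public using (sum-syntax)
  open Sum *-monoid public using () renaming (sum to product)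

  infixl 10 prod-syntax

  prod-syntax : ∀ n → Vector Carrier n → Carrier
  prod-syntax _ = product

  syntax prod-syntax n (λ i → t) = ∏[ i < n ] t

  Matrix : ℕ → Set c
  Matrix n = Fin n → Fin n → Carrier

  minor : ∀ {n} → Matrix (suc n) → Fin (suc n) → Fin (suc n) → Matrix n
  minor M p q i j = M (punchIn p i) (punchIn q j)

  -- Cofactor expansion along the first row.  Indices start at 0, so the
  -- sign (-1)^(1+q) of the 1-based formula becomes (-1)^q.
  det : ∀ {n} → Matrix n → Carrier
  det {zero}  M = 1#
  det {suc n} M =
    ∑[ q < suc n ] ((- 1#) ^ toℕ q * (M zero q * det (minor M zero q)))

  -- With 0-based indices p and q, the 1-based index max(p+1, m+1-(q+1)) of
  -- the entry is, 0-based, max(p, m-1-q), and m-1-q is `opposite q`.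
  C : ∀ m → Vector Carrier m → Matrix m
  C m x p q = x (p ⊔ᶠ opposite q)

  -- (x₁, …, xₘ) extended by xₘ₊₁ = 0.
  extend : ∀ {m} → Vector Carrier m → Vector Carrier (suc m)
  extend {m} x = insertAt x (fromℕ m) 0#

{-# OPTIONS --safe #-}

-- The last two columns of C m x agree below the first row.  For such a matrix
-- only the last two terms of the expansion along the first row survive, since
-- every other minor again has two equal last columns, and these two terms share
-- their minor.  For C m x that minor is C (m - 1) (x₂, …, xₘ), which gives
--   det C m x = (-1)^(m-1) (x₁ - x₂) det C (m - 1) (x₂, …, xₘ).
module Submission where

open import Defs
open import Algebra.Bundles using (CommutativeRing)
open import Data.Fin.Base using (Fin; zero; inject₁; suc; fromℕ; opposite; punchIn; toℕ)
open import Data.Fin.Properties using (≤-totalOrder; ≤-total; toℕ-fromℕ; toℕ-inject₁)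
open import Data.Nat.Base using (ℕ; zero; suc; _≤_; z≤n; s≤s; _∸_)
open import Data.Nat.DivMod using (_/_; m/n≡1+[m∸n]/n)
open import Data.Nat.Divisibility using (_∣_; ∣-refl; ∣m∣n⇒∣m+n)
open import Data.Product.Base using (_×_; _,_)
open import Data.Sum.Base using (inj₁; inj₂)
open import Data.Vec.Functional using (Vector; tail; init; last)
open import Function.Base using (_∘_)
open import Relation.Binary.PropositionalEquality as ≡ using (_≡_)
open import Relation.Nullary.Negation using (¬_; contradiction)
import Algebra.Construct.NaturalChoice.Max as Max
import Algebra.Properties.Ring as RingProperties
import Algebra.Properties.Semiring.Exp as Exp
import Algebra.Properties.Semiring.Sum as Sum
import Relation.Binary.Reasoning.Setoid as ≈-Reasoning

-- Halves of natural numbers, for the exponents of the sign.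

[2+n]/2≡1+n/2 : ∀ n → suc (suc n) / 2 ≡ suc (n / 2)
[2+n]/2≡1+n/2 n = m/n≡1+[m∸n]/n {suc (suc n)} {2} (s≤s (s≤s z≤n))

-- Induction in steps of two: 1 and 0 have the same half, 2 is excluded by the hypothesis, and
-- adding 2 raises both halves by one. This yields the exponent of the odd case.
2∤1+n⇒[1+n]/2≡n/2 : ∀ n → ¬ (2 ∣ suc n) → suc n / 2 ≡ n / 2
2∤1+n⇒[1+n]/2≡n/2 zero          _     = ≡.refl
2∤1+n⇒[1+n]/2≡n/2 (suc zero)    2∤2   = contradiction ∣-refl 2∤2
2∤1+n⇒[1+n]/2≡n/2 (suc (suc n)) 2∤3+n = begin
  suc (suc (suc n)) / 2  ≡⟨ [2+n]/2≡1+n/2 (suc n) ⟩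
  suc (suc n / 2)        ≡⟨ ≡.cong suc (2∤1+n⇒[1+n]/2≡n/2 n (2∤3+n ∘ ∣m∣n⇒∣m+n ∣-refl)) ⟩
  suc (n / 2)            ≡⟨ [2+n]/2≡1+n/2 n ⟨
  suc (suc n) / 2        ∎
  where open ≡.≡-Reasoning

-- Positions of the last two columns, and maxima of indices.

penult : ∀ n → Fin (suc (suc n))
penult n = inject₁ (fromℕ n)

punchIn-fromℕ : ∀ {n} (j : Fin n) → punchIn (fromℕ n) j ≡ inject₁ j
punchIn-fromℕ zero    = ≡.refl
punchIn-fromℕ (suc j) = ≡.cong suc (punchIn-fromℕ j)

punchIn-inject₁-last : ∀ {n} (q : Fin (suc n)) → punchIn (inject₁ q) (fromℕ n) ≡ fromℕ (suc n)
punchIn-inject₁-last         zero    = ≡.refl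
punchIn-inject₁-last {suc n} (suc q) = ≡.cong suc (punchIn-inject₁-last q)

-- The double `inject₁` places the deleted column before the last two. With `punchIn-inject₁-last`,
-- these remain the last two columns of the minor.
punchIn-inject₁²-penult : ∀ {n} (q : Fin (suc n)) →
  punchIn (inject₁ (inject₁ q)) (penult n) ≡ penult (suc n)
punchIn-inject₁²-penult         zero    = ≡.refl
punchIn-inject₁²-penult {suc n} (suc q) = ≡.cong suc (punchIn-inject₁²-penult q)

opposite-inject₁ : ∀ {n} (j : Fin n) → opposite (inject₁ j) ≡ suc (opposite j)
opposite-inject₁ zero    = ≡.refl
opposite-inject₁ (suc j) = ≡.cong inject₁ (opposite-inject₁ j)

opposite-fromℕ : ∀ n → opposite (fromℕ n) ≡ zero
opposite-fromℕ zero    = ≡.refl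
opposite-fromℕ (suc n) = ≡.cong inject₁ (opposite-fromℕ n)

suc-⊔ᶠ : ∀ {n} (i j : Fin n) → suc i ⊔ᶠ suc j ≡ suc (i ⊔ᶠ j)
suc-⊔ᶠ {n} i j with ≤-total i j
... | inj₁ i≤j = ≡.trans (x≤y⇒x⊔y≈y′ (s≤s i≤j)) (≡.cong suc (≡.sym (x≤y⇒x⊔y≈y i≤j)))
  where
  open Max (≤-totalOrder n) using (x≤y⇒x⊔y≈y)
  open Max (≤-totalOrder (suc n)) using () renaming (x≤y⇒x⊔y≈y to x≤y⇒x⊔y≈y′)
... | inj₂ j≤i = ≡.trans (x≤y⇒y⊔x≈y′ (s≤s j≤i)) (≡.cong suc (≡.sym (x≤y⇒y⊔x≈y j≤i)))
  where
  open Max (≤-totalOrder n) using (x≤y⇒y⊔x≈y)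
  open Max (≤-totalOrder (suc n)) using () renaming (x≤y⇒y⊔x≈y to x≤y⇒y⊔x≈y′)

suc-⊔ᶠ-zero : ∀ {n} (i : Fin n) → suc i ⊔ᶠ zero ≡ suc i
suc-⊔ᶠ-zero {n} i = Max.x≤y⇒y⊔x≈y (≤-totalOrder (suc n)) z≤n

-- With `suc-⊔ᶠ-zero`, this makes the last two columns of `C m x` agree below the first row: there
-- `opposite` takes the values 1 and 0, and neither exceeds the row index.
suc-⊔ᶠ-one : ∀ {n} (i : Fin (suc n)) → suc i ⊔ᶠ suc zero ≡ suc i
suc-⊔ᶠ-one {n} i = Max.x≤y⇒y⊔x≈y (≤-totalOrder (suc (suc n))) (s≤s z≤n)

zero-⊔ᶠ : ∀ {n} (j : Fin (suc n)) → zero ⊔ᶠ j ≡ j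
zero-⊔ᶠ {n} j = Max.x≤y⇒x⊔y≈y (≤-totalOrder (suc n)) z≤n

module Determinants {c ℓ} (R : CommutativeRing c ℓ) where

  open CommutativeRing R hiding (zero)
  open Matrices R
  open RingProperties ring
    using (-1*x≈-x; -‿distribˡ-*; -‿distribʳ-*; -‿involutive; [y-z]x≈yx-zx)
  open Exp semiring using (^-congʳ)
  open Sum semiring using (sum; sum-cong-≋; sum-replicate-zero; sum-init-last)
  open ≈-Reasoning setoid

  -- Determinants of matrices whose last two columns agree.

  sum-zero : ∀ {n} (t : Vector Carrier n) → (∀ i → t i ≈ 0#) → sum t ≈ 0#
  sum-zero {n} t t≈0 = trans (sum-cong-≋ t≈0) (sum-replicate-zero n)

  det-cong : ∀ {n} {M N : Matrix n} → (∀ i j → M i j ≈ N i j) → det M ≈ det N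
  det-cong {zero}  M≈N = refl
  det-cong {suc n} M≈N = sum-cong-≋ λ q → *-congˡ {(- 1#) ^ toℕ q}
    (*-cong (M≈N zero q) (det-cong λ i j → M≈N (suc i) (punchIn q j)))

  -- The two sides list `f` without its next-to-last and without its last entry. They differ only in
  -- the final place, where one has `last f` and the other `f (penult n)`.
  punchIn-penult-cong : ∀ {n} (f : Vector Carrier (suc (suc n))) →
    f (penult n) ≈ last f → ∀ j → f (punchIn (penult n) j) ≈ f (inject₁ j)
  punchIn-penult-cong {zero}  f eq zero    = sym eq
  punchIn-penult-cong {suc n} f eq zero    = refl
  punchIn-penult-cong {suc n} f eq (suc j) = punchIn-penult-cong (tail f) eq j

  -1*x*-y≈x*y : ∀ x y → (- 1# * x) * (- y) ≈ x * y
  -1*x*-y≈x*y x y = begin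
    (- 1# * x) * (- y)  ≈⟨ *-congʳ (-1*x≈-x x) ⟩
    - x * - y           ≈⟨ -‿distribˡ-* x (- y) ⟨
    - (x * - y)         ≈⟨ -‿cong (-‿distribʳ-* x y) ⟨
    - - (x * y)         ≈⟨ -‿involutive (x * y) ⟩
    x * y               ∎

  -- Here `s` is the sign of the next-to-last column, `a` and `b` are the last two entries of the
  -- first row, and `d` is the shared minor. The factor `- 1# * s` is the next power of -1 unfolded.
  combine-terms : ∀ s a b d →
    s * (a * d) + (- 1# * s) * (b * d) ≈ (- 1# * s) * ((b - a) * d)
  combine-terms s a b d = begin
    s * (a * d) + (- 1# * s) * (b * d)                    ≈⟨ +-comm _ _ ⟩
    (- 1# * s) * (b * d) + s * (a * d)                    ≈⟨ +-congˡ (-1*x*-y≈x*y s (a * d)) ⟨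
    (- 1# * s) * (b * d) + (- 1# * s) * (- (a * d))       ≈⟨ distribˡ _ _ _ ⟨
    (- 1# * s) * (b * d - a * d)                          ≈⟨ *-congˡ ([y-z]x≈yx-zx d b a) ⟨
    (- 1# * s) * ((b - a) * d)                            ∎

  mutual

    det-last-columns-agree-below : ∀ n (M : Matrix (suc (suc n))) →
      (∀ i → M (suc i) (penult n) ≈ last (M (suc i))) →
      det M ≈ (- 1#) ^ suc n *
        ((last (M zero) - M zero (penult n)) * det (minor M zero (fromℕ (suc n))))
    det-last-columns-agree-below n M agree = begin
      sum t                                               ≈⟨ sum-init-last t ⟩
      sum (init t) + last t                               ≈⟨ +-congʳ (sum-init-last (init t)) ⟩
      (sum (init (init t)) + t (penult n)) + last t       ≈⟨ +-congʳ (+-congʳ (sum-zero _ (vanish n M agree))) ⟩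
      (0# + t (penult n)) + last t                        ≈⟨ +-congʳ (+-identityˡ _) ⟩
      t (penult n) + last t                               ≈⟨ +-cong penult-term last-term ⟩
      s * (a * d) + (- 1# * s) * (b * d)                  ≈⟨ combine-terms s a b d ⟩
      (- 1# * s) * ((b - a) * d)                          ∎
      where
      t : Vector Carrier (suc (suc n))
      t q = (- 1#) ^ toℕ q * (M zero q * det (minor M zero q))
      s = (- 1#) ^ n
      a = M zero (penult n)
      b = last (M zero)
      d = det (minor M zero (fromℕ (suc n)))

      same-minor : det (minor M zero (penult n)) ≈ d
      same-minor = det-cong λ i j →
        trans (punchIn-penult-cong (M (suc i)) (agree i) j)
              (sym (reflexive (≡.cong (M (suc i)) (punchIn-fromℕ j))))

      penult-term : t (penult n) ≈ s * (a * d)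
      penult-term = *-cong
        (^-congʳ (- 1#) (≡.trans (toℕ-inject₁ (fromℕ n)) (toℕ-fromℕ n)))
        (*-congˡ same-minor)

      last-term : last t ≈ (- 1# * s) * (b * d)
      last-term = *-congʳ (^-congʳ (- 1#) (toℕ-fromℕ (suc n)))

    -- The minor loses the first row, the only one where the last two columns may differ, so they
    -- agree throughout and the recursion applies at one size smaller. For `n` equal to 0 no column
    -- precedes the last two.
    vanish : ∀ n (M : Matrix (suc (suc n))) →
      (∀ i → M (suc i) (penult n) ≈ last (M (suc i))) →
      ∀ q → let q″ = inject₁ (inject₁ q) in
      (- 1#) ^ toℕ q″ * (M zero q″ * det (minor M zero q″)) ≈ 0#
    vanish (suc n) M agree q = begin
      (- 1#) ^ toℕ q″ * (M zero q″ * det (minor M zero q″))  ≈⟨ *-congˡ (*-congˡ minor≈0) ⟩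
      (- 1#) ^ toℕ q″ * (M zero q″ * 0#)                     ≈⟨ *-congˡ (zeroʳ _) ⟩
      (- 1#) ^ toℕ q″ * 0#                                   ≈⟨ zeroʳ _ ⟩
      0#                                                     ∎
      where
      q″ = inject₁ (inject₁ q)
      minor≈0 : det (minor M zero q″) ≈ 0#
      minor≈0 = det-last-columns-equal n (minor M zero q″) λ i → begin
        M (suc i) (punchIn q″ (penult n))        ≡⟨ ≡.cong (M (suc i)) (punchIn-inject₁²-penult q) ⟩
        M (suc i) (penult (suc n))               ≈⟨ agree i ⟩
        last (M (suc i))                         ≡⟨ ≡.cong (M (suc i)) (punchIn-inject₁-last (inject₁ q)) ⟨
        M (suc i) (punchIn q″ (fromℕ (suc n)))   ∎

    -- Agreement in the first row as well makes the factor `b - a` zero.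
    det-last-columns-equal : ∀ n (M : Matrix (suc (suc n))) →
      (∀ i → M i (penult n) ≈ last (M i)) → det M ≈ 0#
    det-last-columns-equal n M equal = begin
      det M                  ≈⟨ det-last-columns-agree-below n M (equal ∘ suc) ⟩
      s * ((b - a) * d)      ≈⟨ *-congˡ (*-congʳ (+-congˡ (-‿cong (equal zero)))) ⟩
      s * ((b - b) * d)      ≈⟨ *-congˡ (*-congʳ (-‿inverseʳ b)) ⟩
      s * (0# * d)           ≈⟨ *-congˡ (zeroˡ d) ⟩
      s * 0#                 ≈⟨ zeroʳ s ⟩
      0#                     ∎
      where
      s = (- 1#) ^ suc n
      a = M zero (penult n)
      b = last (M zero)
      d = det (minor M zero (fromℕ (suc n)))

  -- The recursion for `det (C m x)` and its solution.

  C-last : ∀ n (x : Vector Carrier (suc n)) p → last (C (suc n) x p) ≡ x (p ⊔ᶠ zero)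
  C-last n x p = ≡.cong (λ j → x (p ⊔ᶠ j)) (opposite-fromℕ n)

  C-penult : ∀ n (x : Vector Carrier (suc (suc n))) p →
    C (suc (suc n)) x p (penult n) ≡ x (p ⊔ᶠ suc zero)
  C-penult n x p = ≡.cong (λ j → x (p ⊔ᶠ j))
    (≡.trans (opposite-inject₁ (fromℕ n)) (≡.cong suc (opposite-fromℕ n)))

  -- Deleting the first row raises the row index by one, and deleting the last column raises
  -- `opposite` by one. The maximum therefore rises by one, which is the shift from `x` to `tail x`.
  minor-C : ∀ n (x : Vector Carrier (suc n)) i j →
    minor (C (suc n) x) zero (fromℕ n) i j ≡ C n (tail x) i j
  minor-C n x i j = ≡.cong x (≡.trans
    (≡.cong (suc i ⊔ᶠ_) (≡.trans (≡.cong opposite (punchIn-fromℕ j)) (opposite-inject₁ j)))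
    (suc-⊔ᶠ i (opposite j)))

  det-C-step : ∀ n (x : Vector Carrier (suc n)) →
    det (C (suc n) x) ≈
      (- 1#) ^ n * ((extend x zero - extend x (suc zero)) * det (C n (tail x)))
  -- A single column has no neighbour to subtract; the subtrahend is the appended entry 0 of
  -- `extend x`.
  det-C-step zero x = begin
    1# * (x zero * 1#) + 0#   ≈⟨ +-identityʳ _ ⟩
    1# * (x zero * 1#)        ≈⟨ *-congˡ (*-congʳ x₀≈x₀-0) ⟩
    1# * ((x zero - 0#) * 1#) ∎
    where
    x₀≈x₀-0 : x zero ≈ x zero - 0#
    x₀≈x₀-0 = begin
      x zero              ≈⟨ +-identityʳ _ ⟨
      x zero + 0#         ≈⟨ +-congˡ (-‿inverseʳ 0#) ⟨
      x zero + (0# - 0#)  ≈⟨ +-congˡ (+-identityˡ _) ⟩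
      x zero - 0#         ∎
  det-C-step (suc n) x = begin
    det M                                           ≈⟨ det-last-columns-agree-below n M agree ⟩
    (- 1#) ^ suc n *
      ((last (M zero) - M zero (penult n)) *
        det (minor M zero (fromℕ (suc n))))         ≈⟨ *-congˡ (*-cong (+-cong last₀ (-‿cong penult₀)) minor≈C) ⟩
    (- 1#) ^ suc n *
      ((x zero - x (suc zero)) *
        det (C (suc n) (tail x)))                   ∎
    where
    M = C (suc (suc n)) x

    agree : ∀ i → M (suc i) (penult n) ≈ last (M (suc i))
    agree i = reflexive (≡.trans (C-penult n x (suc i)) (≡.trans
      (≡.cong x (≡.trans (suc-⊔ᶠ-one i) (≡.sym (suc-⊔ᶠ-zero i))))
      (≡.sym (C-last (suc n) x (suc i)))))

    last₀ : last (M zero) ≈ x zero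
    last₀ = reflexive (≡.trans (C-last (suc n) x zero) (≡.cong x (zero-⊔ᶠ zero)))

    penult₀ : M zero (penult n) ≈ x (suc zero)
    penult₀ = reflexive (≡.trans (C-penult n x zero) (≡.cong x (zero-⊔ᶠ (suc zero))))

    minor≈C : det (minor M zero (fromℕ (suc n))) ≈ det (C (suc n) (tail x))
    minor≈C = det-cong λ i j → reflexive (minor-C (suc n) x i j)

  -- The exponents n + floor(n/2) and floor((n+1)/2) differ by the even number 2 floor(n/2). In the
  -- induction by twos the left exponent grows by 3 and the right by 1, so one pair of factors -1
  -- cancels.
  sign-step : ∀ n → (- 1#) ^ n * (- 1#) ^ (n / 2) ≈ (- 1#) ^ (suc n / 2)
  sign-step zero          = *-identityˡ 1#
  sign-step (suc zero)    = *-identityʳ _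
  sign-step (suc (suc n)) = begin
    (ε * (ε * ε ^ n)) * ε ^ (suc (suc n) / 2) ≈⟨ *-cong ε*[ε*y]≈y (^-congʳ ε ([2+n]/2≡1+n/2 n)) ⟩
    ε ^ n * (ε * ε ^ (n / 2))                 ≈⟨ *-assoc _ _ _ ⟨
    (ε ^ n * ε) * ε ^ (n / 2)                 ≈⟨ *-congʳ (*-comm _ _) ⟩
    (ε * ε ^ n) * ε ^ (n / 2)                 ≈⟨ *-assoc _ _ _ ⟩
    ε * (ε ^ n * ε ^ (n / 2))                 ≈⟨ *-congˡ (sign-step n) ⟩
    ε * ε ^ (suc n / 2)                       ≡⟨ ≡.cong (ε ^_) ([2+n]/2≡1+n/2 (suc n)) ⟨
    ε ^ (suc (suc (suc n)) / 2)               ∎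
    where
    ε = - 1#
    ε*[ε*y]≈y : ∀ {y} → ε * (ε * y) ≈ y
    ε*[ε*y]≈y {y} = begin
      ε * (ε * y)  ≈⟨ -1*x≈-x _ ⟩
      - (ε * y)    ≈⟨ -‿cong (-1*x≈-x y) ⟩
      - - y        ≈⟨ -‿involutive y ⟩
      y            ∎

  -- With the rounded half `m / 2` as exponent, one formula covers both parities, so the induction
  -- can go from `n` to `suc n`.
  det-C : ∀ m (x : Vector Carrier m) →
    det (C m x) ≈ (- 1#) ^ (m / 2) * (∏[ i < m ] (extend x (inject₁ i) - extend x (suc i)))
  det-C zero    x = sym (*-identityˡ 1#)
  det-C (suc n) x = begin
    det (C (suc n) x)               ≈⟨ det-C-step n x ⟩
    s * (y * det (C n (tail x)))    ≈⟨ *-congˡ (*-congˡ (det-C n (tail x))) ⟩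
    s * (y * (s′ * p))              ≈⟨ *-congˡ (*-assoc y s′ p) ⟨
    s * ((y * s′) * p)              ≈⟨ *-congˡ (*-congʳ (*-comm y s′)) ⟩
    s * ((s′ * y) * p)              ≈⟨ *-congˡ (*-assoc s′ y p) ⟩
    s * (s′ * (y * p))              ≈⟨ *-assoc s s′ (y * p) ⟨
    (s * s′) * (y * p)              ≈⟨ *-congʳ (sign-step n) ⟩
    (- 1#) ^ (suc n / 2) * (y * p)  ∎
    where
    s  = (- 1#) ^ n
    s′ = (- 1#) ^ (n / 2)
    y  = extend x zero - extend x (suc zero)
    -- `extend x (suc j)` computes to `extend (tail x) j`, so `y * p` is the full product over
    -- `suc n` by unfolding.
    p  = ∏[ i < n ] (extend (tail x) (inject₁ i) - extend (tail x) (suc i))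

proposition1p3 : ∀ {c ℓ} (R : CommutativeRing c ℓ) →
    let open CommutativeRing R in
    let open Matrices R in
    (m : ℕ) → 1 ≤ m → (x : Vector Carrier m) →
    (2 ∣ m → det (C m x) ≈ (- 1#) ^ (m / 2) * (∏[ i < m ] (extend x (inject₁ i) - extend x (suc i))))
    × (¬ (2 ∣ m) → det (C m x) ≈ (- 1#) ^ ((m ∸ 1) / 2) * (∏[ i < m ] (extend x (inject₁ i) - extend x (suc i))))
proposition1p3 R (suc n) _ x =
    (λ _ → det-C (suc n) x)
  -- For odd m, `m / 2` rounds down to `(m ∸ 1) / 2`.
  , (λ 2∤m → trans (det-C (suc n) x) (*-congʳ (^-congʳ (- 1#) (2∤1+n⇒[1+n]/2≡n/2 n 2∤m))))
  where
  open CommutativeRing R using (trans; *-congʳ; -_; 1#; semiring)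
  open Exp semiring using (^-congʳ)
  open Determinants R
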